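{- Every Turing-recognizable (i.e. recursively enumerable) language can be recognized by a one-way q-alternating finite automaton (q-1AFA).
   Context: **Superoperators.** A superoperator on a finite-dimensional quantum register is a finite family $\mathcal{E}=\{E_1,\dots,E_k\}$ of square matrices with rational entries with $\sum_{i=1}^k E_i^\dagger E_i=I$. **qATM.** A q-alternating Turing machine (qATM) is an alternating Turing machine (read-only two-way input tape, read/write work tape; states are existential, universal, accepting or rejecting) augmented with a quantum register of fixed dimension (independent of the input). A configuration is a pair $(c,|\psi\rangle)$, where $c$ is a classical configuration and $|\psi\rangle$ is the state of the register. Let $c_1,\dots,c_{k_c}$ be the successors of $c$ given by the classical transition function. If $c$ is existential, the successors of $(c,|\psi\rangle)$ are $(c_i,|\psi\rangle)$, $1\le i\le k_c$. If $c$ is universal, a superoperator $\mathcal{E}_c=\{E_{c,1},\dots,E_{c,k_c}\}$, determined by the classical state and the symbols under the heads, is applied: with $|\widetilde{\psi_i}\rangle=E_{c,i}|\psi\rangle$ and $p_i=\langle\widetilde{\psi_i}|\widetilde{\psi_i}\rangle$, the successors are $(c_i,|\widetilde{\psi_i}\rangle/\sqrt{p_i})$ for those $i$ with $p_i>0$ (branches with $p_i=0$ do not exist). The computation starts in the initial classical configuration and a fixed initial quantum state, and a path stops when it enters an accepting or rejecting configuration. An input is accepted iff the computation tree contains a finite accepting subtree for some nondeterministic strategy: i.e. a finite subtree containing the root, containing one successor of each of its existential nodes and all successors of each of its universal nodes, all of whose leaves are accepting. The machine recognizes the set of accepted inputs. **q-1AFA.** A q-1AFA is a qATM without work tape whose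 input head is one-way (it never moves left; it may stay put). The input is delimited by end symbols. -}

module Defs where

open import Algebra.Bundles using (CommutativeRing)
open import Data.Bool.Base using (if_then_else_)
open import Data.Fin.Base using (Fin)
open import Data.Fin.Properties using (_≟_)
open import Data.List.Base using (List; []; _∷_; map)
open import Data.Nat.Base using (ℕ; zero; suc)
open import Data.Product.Base using (_×_; _,_; Σ-syntax; ∃-syntax)
open import Data.Rational.Base
  using (ℚ; 0ℚ; 1ℚ; _*_; _<_; _÷_; 1/_; NonZero; NonNegative; Positive; positive)
open import Data.Rational.Properties
  using (+-*-commutativeRing; *-cancelʳ-<-nonNeg; *-zeroˡ; 1/pos⇒pos; pos⇒nonNeg; pos⇒nonZero)
open import Data.Vec.Functional using (Vector; transpose)
open import Level using (Level)
open import Relation.Binary.Construct.Closure.ReflexiveTransitive using (Star)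
open import Relation.Binary.PropositionalEquality using (_≡_; _≢_; subst; sym)
open import Relation.Nullary.Decidable.Core using (does)
open import Relation.Unary using (Pred; _≐_)

open import Algebra.Properties.Semiring.Sum
  (CommutativeRing.semiring +-*-commutativeRing) using (sum)

private
  variable
    ℓ : Level
    k d : ℕ

Language : ℕ → (ℓ : Level) → Set _
Language k ℓ = Pred (List (Fin k)) ℓ

------------------------------------------------------------------------
-- Turing machines: deterministic, one two-way infinite tape

data TapeSymbol (k g : ℕ) : Set where
  blank : TapeSymbol k g
  input : Fin k → TapeSymbol k g
  extra : Fin g → TapeSymbol k g

data Direction : Set where
  left right : Direction

record TuringMachine (k : ℕ) : Set where
  field
    #states #extra        : ℕ
    start accept reject   : Fin #states
    accept≢reject         : accept ≢ reject
    δ : Fin #states → TapeSymbol k #extra →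
        Fin #states × TapeSymbol k #extra × Direction

module TM {k : ℕ} (M : TuringMachine k) where
  open TuringMachine M

  Γ : Set
  Γ = TapeSymbol k #extra

  -- `before` lists the cells to the left of the head, nearest first, and
  -- `after` those to its right; all cells beyond the lists are blank.
  record Config : Set where
    constructor config
    field
      state   : Fin #states
      before  : List Γ
      scanned : Γ
      after   : List Γ

  shift : Direction → Fin #states → List Γ → Γ → List Γ → Config
  shift right q ls       a []       = config q (a ∷ ls) blank []
  shift right q ls       a (r ∷ rs) = config q (a ∷ ls) r rs
  shift left  q []       a rs       = config q [] blank (a ∷ rs)
  shift left  q (l ∷ ls) a rs       = config q ls l (a ∷ rs)

  next : Config → Config
  next (config q ls a rs) =
    let (q′ , b , dir) = δ q a in shift dir q′ ls b rs

  data _⟶_ (c : Config) : Config → Set where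
    step : Config.state c ≢ accept → Config.state c ≢ reject → c ⟶ next c

  initial : List (Fin k) → Config
  initial []      = config start [] blank []
  initial (a ∷ w) = config start [] (input a) (map input w)

  Accepts : List (Fin k) → Set
  Accepts w = ∃[ c ] Star _⟶_ (initial w) c × Config.state c ≡ accept

TuringRecognizable : Language k ℓ → Set _
TuringRecognizable L = ∃[ M ] L ≐ TM.Accepts M

------------------------------------------------------------------------
-- Quantum registers and superoperators

Matrix : ℕ → Set
Matrix d = Vector (Vector ℚ d) d

⟨_∣_⟩ : Vector ℚ d → Vector ℚ d → ℚ
⟨ u ∣ v ⟩ = sum λ i → u i * v i

infixr 7 _·_ _⊗_

_·_ : Matrix d → Vector ℚ d → Vector ℚ d
(A · v) i = sum λ j → A i j * v j

_⊗_ : Matrix d → Matrix d → Matrix d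
(A ⊗ B) i j = sum λ m → A i m * B m j

𝟙 : Matrix d
𝟙 i j = if does (i ≟ j) then 1ℚ else 0ℚ

-- Entries are rational, so the adjoint is the transpose.
_† : Matrix d → Matrix d
_† = transpose

record Superoperator (d k : ℕ) : Set where
  field
    op       : Fin k → Matrix d
    complete : ∀ i j → sum (λ m → ((op m) † ⊗ op m) i j) ≡ 𝟙 i j

-- The quantum state v/√⟨v|v⟩.  The normalising factor is in general
-- irrational, so only the nonzero rational vector v is stored.
record Ket (d : ℕ) : Set where
  constructor ket
  field
    vec    : Vector ℚ d
    norm>0 : 0ℚ < ⟨ vec ∣ vec ⟩

-- With |ψ⟩ = v/√⟨v|v⟩, this is the squared norm of E|ψ⟩.
prob : Matrix d → Ket d → ℚ
prob E (ket v v>0) = ⟨ E · v ∣ E · v ⟩ ÷ ⟨ v ∣ v ⟩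
  where instance _ = pos⇒nonZero ⟨ v ∣ v ⟩ {{positive v>0}}

prob>0⇒norm>0 : ∀ (E : Matrix d) ψ → 0ℚ < prob E ψ →
                0ℚ < ⟨ E · Ket.vec ψ ∣ E · Ket.vec ψ ⟩
prob>0⇒norm>0 E (ket v v>0) p =
  *-cancelʳ-<-nonNeg (1/ n) (subst (_< prob E (ket v v>0)) (sym (*-zeroˡ (1/ n))) p)
  where
  n = ⟨ v ∣ v ⟩
  instance
    pos : Positive n
    pos = positive v>0
    nonZero : NonZero n
    nonZero = pos⇒nonZero n
    nonNegative : NonNegative (1/ n)
    nonNegative = pos⇒nonNeg (1/ n) {{1/pos⇒pos n}}

-- E|ψ⟩/√p, where p = prob E ψ; for |ψ⟩ = v/√⟨v|v⟩ this is Ev/√⟨Ev|Ev⟩.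
collapse : (E : Matrix d) (ψ : Ket d) → 0ℚ < prob E ψ → Ket d
collapse E ψ p = ket (E · Ket.vec ψ) (prob>0⇒norm>0 E ψ p)

------------------------------------------------------------------------
-- One-way q-alternating finite automata

data Symbol (k : ℕ) : Set where
  ⊢ ⊣    : Symbol k
  letter : Fin k → Symbol k

-- The head cannot leave the delimited input ⊢w⊣.
data Move {k : ℕ} (s : Symbol k) : Set where
  stay    : Move s
  forward : s ≢ ⊣ → Move s

record Branches {k : ℕ} (n : ℕ) (s : Symbol k) : Set where
  field
    size   : ℕ
    branch : Fin size → Fin n × Move s

open Branches

data StateRule (k n d : ℕ) : Set where
  accepting rejecting : StateRule k n d
  existential : ((s : Symbol k) → Branches n s) → StateRule k n d
  universal   : ((s : Symbol k) → Σ[ b ∈ Branches n s ] Superoperator d (size b)) →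
                StateRule k n d

record Q1AFA (k : ℕ) : Set where
  field
    #states   : ℕ
    dim       : ℕ
    start     : Fin #states
    start-ket : Ket dim
    rule      : Fin #states → StateRule k #states dim

letterAt : List (Fin k) → ℕ → Symbol k
letterAt []      _       = ⊣
letterAt (a ∷ _) zero    = letter a
letterAt (_ ∷ w) (suc i) = letterAt w i

-- The symbol at a position of ⊢w⊣; ⊢ is at position 0.
scan : List (Fin k) → ℕ → Symbol k
scan w zero    = ⊢
scan w (suc i) = letterAt w i

advance : {s : Symbol k} → Move s → ℕ → ℕ
advance stay        i = i
advance (forward _) i = suc i

module QA {k : ℕ} (A : Q1AFA k) (w : List (Fin k)) where
  open Q1AFA A

  record ClassicalConfig : Set where
    constructor config
    field
      state : Fin #states
      head  : ℕ

  successor : (i : ℕ) → (b : Branches #states (scan w i)) → Fin (size b) →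
              ClassicalConfig
  successor i b j = let (q , m) = branch b j in config q (advance m i)

  -- Finite accepting subtrees of the computation tree, indexed by their
  -- root.  Branching is finite, so well-founded trees are finite.
  data AcceptingSubtree : ClassicalConfig × Ket dim → Set where

    leaf : ∀ {q i ψ} → rule q ≡ accepting →
           AcceptingSubtree (config q i , ψ)

    ∃-node : ∀ {q i ψ δ} → rule q ≡ existential δ →
             (j : Fin (size (δ (scan w i)))) →
             AcceptingSubtree (successor i (δ (scan w i)) j , ψ) →
             AcceptingSubtree (config q i , ψ)

    ∀-node : ∀ {q i ψ δ b ℰ} → rule q ≡ universal δ → δ (scan w i) ≡ (b , ℰ) →
             (∀ j → let E = Superoperator.op ℰ j in
                    (p : 0ℚ < prob E ψ) →
                    AcceptingSubtree (successor i b j , collapse E ψ p)) →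
             AcceptingSubtree (config q i , ψ)

  Accepts : Set
  Accepts = AcceptingSubtree (config start 0 , start-ket)

Q1AFARecognizable : Language k ℓ → Set _
Q1AFARecognizable L = ∃[ A ] L ≐ QA.Accepts A

{-# OPTIONS --safe #-}

-- The register holds a multiple of (1 , l , r), where l and r are the two
-- halves of the tape of the Turing machine read as numerals, so that a machine
-- step is a linear map once the digits next to the head are known.  Those
-- digits are guessed existentially; a guess x of the last digit of r is right
-- iff (r − x)/β is a natural number, which a universal branch checks by counting
-- down to 0.  Zero tests are what quantum branching provides: a branch that
-- measures a coordinate and then rejects exists iff this coordinate is nonzero.
-- Any finite list of matrices becomes, after rescaling, part of a superoperator
-- whose remaining branches accept at once.

module Submission where

open import Defs
open import Algebra.Bundles using (CommutativeRing)
open import Data.Fin.Base using (Fin; zero; suc; toℕ; _↑ˡ_; _↑ʳ_; splitAt; combine; remQuot)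
open import Data.Fin.Properties
  using (_≟_; all?; toℕ-injective; toℕ<n; splitAt-↑ˡ; splitAt-↑ʳ; remQuot-combine)
open import Data.Fin.Patterns using (0F; 1F; 2F; 3F; 4F; 5F; 8F)
open import Data.List.Base using (List; []; _∷_; length; lookup; map)
open import Data.List.Relation.Unary.All as All using (All; []; _∷_)
open import Data.List.Membership.Propositional.Properties using (∈-lookup)
open import Data.Nat.Base as ℕ using (ℕ; zero; suc)
open import Data.Nat.DivMod using (_%_; [m+kn]%n≡m%n; m<n⇒m%n≡m)
import Data.Nat.Properties as ℕ
open import Data.Nat.Solver using () renaming (module +-*-Solver to ℕS)
open import Data.Product.Base using (_×_; _,_; proj₁; proj₂; map₁; uncurry; ∃-syntax)
open import Data.Rational.Base
  using (ℚ; 0ℚ; 1ℚ; _+_; _*_; -_; 1/_; _<_; _≤_; Positive; positive; nonNegative; negative; ≢-nonZero)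
open import Data.Rational.Properties as ℚ using (+-*-commutativeRing)
open import Data.Rational.Solver using (module +-*-Solver)
open import Data.Sum.Base using (inj₁; inj₂; [_,_]′)
open import Function.Bundles using (_⇔_; mk⇔; Equivalence)
open import Data.Vec.Functional using (Vector)
open import Level using (Level)
open import Relation.Binary.Construct.Closure.ReflexiveTransitive using (Star; ε; _◅_)
open import Relation.Binary.PropositionalEquality
open import Relation.Binary.Definitions using (tri<; tri≈; tri>)
open import Relation.Nullary using (¬_; Dec; yes; no; contradiction)
open import Relation.Nullary.Decidable using (from-yes; decidable-stable)
open import Algebra.Properties.Semiring.Sum
  (CommutativeRing.semiring +-*-commutativeRing) using (sum)
open import Algebra.Properties.Semiring.Mult
  (CommutativeRing.semiring +-*-commutativeRing) using (×-homo-+; ×1-homo-*) renaming (_×_ to _×′_)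
open import Algebra.Properties.Group ℚ.+-0-group using (∙-cancelˡ)

open +-*-Solver using (Polynomial; solve; _:=_; con)
  renaming (_:+_ to _⊕_; _:*_ to _⊛_; :-_ to ⊖_)

private
  variable
    A : Set

-- Completing a 3 × 3 matrix to a multiple of an isometry

⟪_,_,_⟫ : A → A → A → Vector A 3
⟪ x , y , z ⟫ 0F = x
⟪ x , y , z ⟫ 1F = y
⟪ x , y , z ⟫ 2F = z

infixr 7 _⋆_

_⋆_ : ∀ {d} → ℚ → Matrix d → Matrix d
(c ⋆ M) i j = c * M i j

gram : Matrix 3 → Matrix 3
gram M = M † ⊗ M

-- The matrix of v ↦ a × v, over any type with a zero and a negation so that
-- it can be instantiated with polynomials in the proof of `cross-gram`.
skew : A → (A → A) → Vector A 3 → Vector (Vector A 3) 3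
skew 0# neg a = ⟪ ⟪ 0#         , neg (a 2F) , a 1F       ⟫
                , ⟪ a 2F       , 0#         , neg (a 0F) ⟫
                , ⟪ neg (a 1F) , a 0F       , 0#         ⟫ ⟫

cross : Vector ℚ 3 → Matrix 3
cross = skew 0ℚ (λ p → - p)

-- The polarised form of ⟨a, v⟩² + |a × v|² = |a|² |v|². For concrete indices each entry is a
-- polynomial identity in the coordinates of a.
cross-gram : ∀ a i j → a i * a j + gram (cross a) i j ≡ ⟨ a ∣ a ⟩ * 𝟙 i j
cross-gram a = λ where
    0F 0F → solve 3 (identity 0F 0F) refl x y z
    0F 1F → solve 3 (identity 0F 1F) refl x y z
    0F 2F → solve 3 (identity 0F 2F) refl x y z
    1F 0F → solve 3 (identity 1F 0F) refl x y z
    1F 1F → solve 3 (identity 1F 1F) refl x y z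
    1F 2F → solve 3 (identity 1F 2F) refl x y z
    2F 0F → solve 3 (identity 2F 0F) refl x y z
    2F 1F → solve 3 (identity 2F 1F) refl x y z
    2F 2F → solve 3 (identity 2F 2F) refl x y z
  where
  x = a 0F
  y = a 1F
  z = a 2F

  Σ₃ : Vector (Polynomial 3) 3 → Polynomial 3
  Σ₃ f = f 0F ⊕ (f 1F ⊕ (f 2F ⊕ con 0ℚ))

  identity : Fin 3 → Fin 3 → (x y z : Polynomial 3) → Polynomial 3 × Polynomial 3
  identity i j x y z = v i ⊛ v j ⊕ Σ₃ (λ m → K m i ⊛ K m j) := Σ₃ (λ m → v m ⊛ v m) ⊛ con (𝟙 i j)
    where
    v = ⟪ x , y , z ⟫
    K = skew (con 0ℚ) ⊖_ v

-- The squared Frobenius norm.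
∥_∥² : Matrix 3 → ℚ
∥ M ∥² = ⟨ M 0F ∣ M 0F ⟩ + (⟨ M 1F ∣ M 1F ⟩ + ⟨ M 2F ∣ M 2F ⟩)

-- Lagrange's identity, row by row: the cross product matrices complete M to a
-- multiple of an isometry.
row-fillers : ∀ (M : Matrix 3) i j → gram M i j +
              (gram (cross (M 0F)) i j + (gram (cross (M 1F)) i j + gram (cross (M 2F)) i j))
              ≡ ∥ M ∥² * 𝟙 i j
row-fillers M i j = begin
  gram M i j + (g 0F + (g 1F + g 2F))
    ≡⟨ solve 6 (λ a b c x y z → (a ⊕ (b ⊕ (c ⊕ con 0ℚ))) ⊕ (x ⊕ (y ⊕ z))
          := (a ⊕ x) ⊕ ((b ⊕ y) ⊕ (c ⊕ z))) refl
          (M 0F i * M 0F j) (M 1F i * M 1F j) (M 2F i * M 2F j) (g 0F) (g 1F) (g 2F) ⟩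
  (M 0F i * M 0F j + g 0F) + ((M 1F i * M 1F j + g 1F) + (M 2F i * M 2F j + g 2F))
    ≡⟨ cong₂ _+_ (cross-gram (M 0F) i j) (cong₂ _+_ (cross-gram (M 1F) i j) (cross-gram (M 2F) i j)) ⟩
  n 0F * 𝟙 i j + (n 1F * 𝟙 i j + n 2F * 𝟙 i j)
    ≡⟨ solve 4 (λ a b c δ → a ⊛ δ ⊕ (b ⊛ δ ⊕ c ⊛ δ) := (a ⊕ (b ⊕ c)) ⊛ δ) refl
         (n 0F) (n 1F) (n 2F) (𝟙 i j) ⟩
  ∥ M ∥² * 𝟙 i j ∎
  where
  open ≡-Reasoning
  g = λ r → gram (cross (M r)) i j
  n = λ r → ⟨ M r ∣ M r ⟩

gram-⋆ : ∀ c M i j → gram (c ⋆ M) i j ≡ c * c * gram M i j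
gram-⋆ c M i j =
  solve 7 (λ c x₀ y₀ x₁ y₁ x₂ y₂ →
    (c ⊛ x₀) ⊛ (c ⊛ y₀) ⊕ ((c ⊛ x₁) ⊛ (c ⊛ y₁) ⊕ ((c ⊛ x₂) ⊛ (c ⊛ y₂) ⊕ con 0ℚ))
    := c ⊛ c ⊛ (x₀ ⊛ y₀ ⊕ (x₁ ⊛ y₁ ⊕ (x₂ ⊛ y₂ ⊕ con 0ℚ)))) refl
    c (M 0F i) (M 0F j) (M 1F i) (M 1F j) (M 2F i) (M 2F j)

gram-𝟙 : ∀ i j → gram 𝟙 i j ≡ 𝟙 i j
gram-𝟙 = from-yes (all? λ i → all? λ j → gram 𝟙 i j ℚ.≟ 𝟙 i j)

-- Norms and the existence of branches

0<square : ∀ {p} → p ≢ 0ℚ → 0ℚ < p * p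
0<square {p} p≢0 with ℚ.<-cmp p 0ℚ
... | tri< p<0 _ _ = ℚ.positive⁻¹ (p * p) {{ℚ.neg*neg⇒pos p {{negative p<0}} p {{negative p<0}}}}
... | tri≈ _ p≡0 _ = contradiction p≡0 p≢0
... | tri> _ _ 0<p = ℚ.positive⁻¹ (p * p) {{ℚ.pos*pos⇒pos p {{positive 0<p}} p {{positive 0<p}}}}

0≤square : ∀ p → 0ℚ ≤ p * p
0≤square p with p ℚ.≟ 0ℚ
... | yes refl = ℚ.≤-refl
... | no p≢0   = ℚ.<⇒≤ (0<square p≢0)

0≤⟨v∣v⟩ : ∀ {d} (v : Vector ℚ d) → 0ℚ ≤ ⟨ v ∣ v ⟩
0≤⟨v∣v⟩ {zero}  v = ℚ.≤-refl
0≤⟨v∣v⟩ {suc d} v = ℚ.+-mono-≤ (0≤square (v zero)) (0≤⟨v∣v⟩ (λ i → v (suc i)))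

0<⟨v∣v⟩ : ∀ {d} (v : Vector ℚ d) i → v i ≢ 0ℚ → 0ℚ < ⟨ v ∣ v ⟩
0<⟨v∣v⟩ {suc d} v zero    vᵢ≢0 = ℚ.+-mono-<-≤ (0<square vᵢ≢0) (0≤⟨v∣v⟩ (λ i → v (suc i)))
0<⟨v∣v⟩ {suc d} v (suc i) vᵢ≢0 = ℚ.+-mono-≤-< (0≤square (v zero)) (0<⟨v∣v⟩ (λ i → v (suc i)) i vᵢ≢0)

⟨v∣v⟩≡0 : ∀ {d} (v : Vector ℚ d) → (∀ i → v i ≡ 0ℚ) → ⟨ v ∣ v ⟩ ≡ 0ℚ
⟨v∣v⟩≡0 {zero}  v v≡0 = refl
⟨v∣v⟩≡0 {suc d} v v≡0 rewrite v≡0 zero | ⟨v∣v⟩≡0 (λ i → v (suc i)) (λ i → v≡0 (suc i)) = refl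

-- Probability is the norm of the image divided by a positive number. With `prob≯0`, this turns the
-- existence of a branch into a question about single coordinates.
0<prob : ∀ {d} (E : Matrix d) ψ i → (E · Ket.vec ψ) i ≢ 0ℚ → 0ℚ < prob E ψ
0<prob E (ket v v>0) i Evᵢ≢0 = ℚ.positive⁻¹ (prob E (ket v v>0))
  {{ℚ.pos*pos⇒pos ⟨ E · v ∣ E · v ⟩ {{positive (0<⟨v∣v⟩ (E · v) i Evᵢ≢0)}}
                  ((1/ ⟨ v ∣ v ⟩) {{ℚ.pos⇒nonZero ⟨ v ∣ v ⟩ {{positive v>0}}}})
                  {{ℚ.1/pos⇒pos ⟨ v ∣ v ⟩ {{positive v>0}}}}}}

prob≯0 : ∀ {d} (E : Matrix d) ψ → (∀ i → (E · Ket.vec ψ) i ≡ 0ℚ) → ¬ 0ℚ < prob E ψ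
prob≯0 E ψ Ev≡0 p = ℚ.<-irrefl (sym (⟨v∣v⟩≡0 _ Ev≡0)) (prob>0⇒norm>0 E ψ p)

0≤∥M∥² : ∀ M → 0ℚ ≤ ∥ M ∥²
0≤∥M∥² M = ℚ.+-mono-≤ (0≤⟨v∣v⟩ (M 0F)) (ℚ.+-mono-≤ (0≤⟨v∣v⟩ (M 1F)) (0≤⟨v∣v⟩ (M 2F)))

-- Extending a list of matrices to a superoperator

module _ {X : Set} where

  total : List (Matrix 3 × X) → ℚ
  total []            = 0ℚ
  total ((M , _) ∷ L) = ∥ M ∥² + total L

  0≤total : ∀ L → 0ℚ ≤ total L
  0≤total []            = ℚ.≤-refl
  0≤total ((M , _) ∷ L) = ℚ.+-mono-≤ (0≤∥M∥² M) (0≤total L)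

  module _ (x₀ : X) where

    -- Each matrix and its three fillers have Gram matrices adding up to `c * c * ∥ M ∥²` times the
    -- identity; the closing `e ⋆ 𝟙` supplies what is missing to 1. All fillers carry the target
    -- `x₀`.
    pad : ℚ → ℚ → List (Matrix 3 × X) → List (Matrix 3 × X)
    pad c e []            = (e ⋆ 𝟙 , x₀) ∷ []
    pad c e ((M , x) ∷ L) = (c ⋆ M , x)
                          ∷ (c ⋆ cross (M 0F) , x₀)
                          ∷ (c ⋆ cross (M 1F) , x₀)
                          ∷ (c ⋆ cross (M 2F) , x₀)
                          ∷ pad c e L

    pad-gram : ∀ c e L i j →
      sum (λ m → gram (proj₁ (lookup (pad c e L) m)) i j) ≡ (c * c * total L + e * e) * 𝟙 i j
    pad-gram c e [] i j = begin
      gram (e ⋆ 𝟙) i j + 0ℚ      ≡⟨ cong (_+ 0ℚ) (gram-⋆ e 𝟙 i j) ⟩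
      e * e * gram 𝟙 i j + 0ℚ    ≡⟨ cong (λ δ → e * e * δ + 0ℚ) (gram-𝟙 i j) ⟩
      e * e * 𝟙 i j + 0ℚ         ≡⟨ solve 3 (λ c e δ → e ⊛ e ⊛ δ ⊕ con 0ℚ
                                      := (c ⊛ c ⊛ con 0ℚ ⊕ e ⊛ e) ⊛ δ) refl c e (𝟙 i j) ⟩
      (c * c * 0ℚ + e * e) * 𝟙 i j ∎
      where open ≡-Reasoning
    pad-gram c e ((M , x) ∷ L) i j = begin
      gram (c ⋆ M) i j + (gram (c ⋆ K 0F) i j + (gram (c ⋆ K 1F) i j + (gram (c ⋆ K 2F) i j + rest)))
        ≡⟨ cong₂ _+_ (gram-⋆ c M i j) (cong₂ _+_ (gram-⋆ c (K 0F) i j)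
             (cong₂ _+_ (gram-⋆ c (K 1F) i j) (cong₂ _+_ (gram-⋆ c (K 2F) i j) (pad-gram c e L i j)))) ⟩
      c * c * gram M i j + (c * c * gram (K 0F) i j + (c * c * gram (K 1F) i j
        + (c * c * gram (K 2F) i j + (c * c * total L + e * e) * 𝟙 i j)))
        ≡⟨ solve 7 (λ c g g₀ g₁ g₂ t δ →
             c ⊛ g ⊕ (c ⊛ g₀ ⊕ (c ⊛ g₁ ⊕ (c ⊛ g₂ ⊕ t ⊛ δ)))
             := c ⊛ (g ⊕ (g₀ ⊕ (g₁ ⊕ g₂))) ⊕ t ⊛ δ) refl
             (c * c) (gram M i j) (gram (K 0F) i j) (gram (K 1F) i j) (gram (K 2F) i j)
             (c * c * total L + e * e) (𝟙 i j) ⟩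
      c * c * (gram M i j + (gram (K 0F) i j + (gram (K 1F) i j + gram (K 2F) i j)))
        + (c * c * total L + e * e) * 𝟙 i j
        ≡⟨ cong (λ s → c * c * s + (c * c * total L + e * e) * 𝟙 i j) (row-fillers M i j) ⟩
      c * c * (∥ M ∥² * 𝟙 i j) + (c * c * total L + e * e) * 𝟙 i j
        ≡⟨ solve 5 (λ c n t e δ → c ⊛ (n ⊛ δ) ⊕ (c ⊛ t ⊕ e) ⊛ δ := (c ⊛ (n ⊕ t) ⊕ e) ⊛ δ) refl
             (c * c) (∥ M ∥²) (total L) (e * e) (𝟙 i j) ⟩
      (c * c * (∥ M ∥² + total L) + e * e) * 𝟙 i j ∎
      where
      open ≡-Reasoning
      K    = λ r → cross (M r)
      rest = sum (λ m → gram (proj₁ (lookup (pad c e L) m)) i j)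

    -- For an accepting target `x₀`, this discharges all filler branches of a universal node at
    -- once.
    pad-All : ∀ {P : Matrix 3 × X → Set} c e L → (∀ E → P (E , x₀)) →
              All (λ (M , x) → P (c ⋆ M , x)) L → All P (pad c e L)
    pad-All c e []      p₀ []       = p₀ _ ∷ []
    pad-All c e (_ ∷ L) p₀ (p ∷ ps) = p ∷ p₀ _ ∷ p₀ _ ∷ p₀ _ ∷ pad-All c e L p₀ ps

2ℚ : ℚ
2ℚ = 1ℚ + 1ℚ

-- With t the total squared norm, c = 2/(1+t) makes 1 − c²t the square of e = (1−t)/(1+t).
module Scale (t : ℚ) (0≤t : 0ℚ ≤ t) where

  1+t>0 : Positive (1ℚ + t)
  1+t>0 = ℚ.pos+nonNeg⇒pos 1ℚ t {{nonNegative 0≤t}}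

  u : ℚ
  u = (1/ (1ℚ + t)) {{ℚ.pos⇒nonZero (1ℚ + t) {{1+t>0}}}}

  -- Opaque: from here on only c ≠ 0 and c²t + e² = 1 matter.
  abstract

    c e : ℚ
    c = 2ℚ * u
    e = (1ℚ + - t) * u

    c≢0 : c ≢ 0ℚ
    c≢0 = ≢-sym (ℚ.<⇒≢ (ℚ.positive⁻¹ c {{ℚ.pos*pos⇒pos 2ℚ u {{ℚ.1/pos⇒pos (1ℚ + t) {{1+t>0}}}}}}))

    c²t+e²≡1 : c * c * t + e * e ≡ 1ℚ
    c²t+e²≡1 = begin
      c * c * t + e * e
        -- Uses 4t + (1 - t)² = (1 + t)².
        ≡⟨ solve 2 (λ t u → let c = con 2ℚ ⊛ u ; e = (con 1ℚ ⊕ ⊖ t) ⊛ u ; v = u ⊛ (con 1ℚ ⊕ t) in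
             c ⊛ c ⊛ t ⊕ e ⊛ e := v ⊛ v) refl t u ⟩
      u * (1ℚ + t) * (u * (1ℚ + t))
        ≡⟨ cong (λ v → v * v) (ℚ.*-inverseˡ (1ℚ + t) {{ℚ.pos⇒nonZero (1ℚ + t) {{1+t>0}}}}) ⟩
      1ℚ ∎
      where open ≡-Reasoning

-- Natural numbers as rationals

ι : ℕ → ℚ
ι n = n ×′ 1ℚ

ι-+ : ∀ m n → ι (m ℕ.+ n) ≡ ι m + ι n
ι-+ = ×-homo-+ 1ℚ

ι-* : ∀ m n → ι (m ℕ.* n) ≡ ι m * ι n
ι-* = ×1-homo-*

0≤ι : ∀ n → 0ℚ ≤ ι n
0≤ι zero    = ℚ.≤-refl
0≤ι (suc n) = ℚ.+-mono-≤ (ℚ.nonNegative⁻¹ 1ℚ) (0≤ι n)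

ι-suc≢0 : ∀ n → ι (suc n) ≢ 0ℚ
ι-suc≢0 n = ≢-sym (ℚ.<⇒≢ (ℚ.+-mono-<-≤ (ℚ.positive⁻¹ 1ℚ) (0≤ι n)))

ι-injective : ∀ {m n} → ι m ≡ ι n → m ≡ n
ι-injective {zero}  {zero}  _  = refl
ι-injective {zero}  {suc n} eq = contradiction (sym eq) (ι-suc≢0 n)
ι-injective {suc m} {zero}  eq = contradiction eq (ι-suc≢0 m)
ι-injective {suc m} {suc n} eq = cong suc (ι-injective (∙-cancelˡ 1ℚ (ι m) (ι n) eq))

*-cancelˡ : ∀ {p q r} → p ≢ 0ℚ → p * q ≡ p * r → q ≡ r
*-cancelˡ {p} {q} {r} p≢0 eq = begin
  q              ≡⟨ unit q ⟨
  1/ p * (p * q) ≡⟨ cong (1/ p *_) eq ⟩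
  1/ p * (p * r) ≡⟨ unit r ⟩
  r              ∎
  where
  open ≡-Reasoning
  instance _ = ≢-nonZero p≢0
  unit : ∀ s → 1/ p * (p * s) ≡ s
  unit s = trans (sym (ℚ.*-assoc (1/ p) p s)) (trans (cong (_* s) (ℚ.*-inverseˡ p)) (ℚ.*-identityˡ s))

*-≢0 : ∀ {p q} → p ≢ 0ℚ → q ≢ 0ℚ → p * q ≢ 0ℚ
*-≢0 {p} p≢0 q≢0 pq≡0 = q≢0 (*-cancelˡ p≢0 (trans pq≡0 (sym (ℚ.*-zeroʳ p))))

-- Homogeneous coordinates

⋆-· : ∀ c (M : Matrix 3) v i → ((c ⋆ M) · v) i ≡ c * (M · v) i
⋆-· c M v i =
  solve 7 (λ c a₀ a₁ a₂ x y z →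
    (c ⊛ a₀) ⊛ x ⊕ ((c ⊛ a₁) ⊛ y ⊕ ((c ⊛ a₂) ⊛ z ⊕ con 0ℚ))
    := c ⊛ (a₀ ⊛ x ⊕ (a₁ ⊛ y ⊕ (a₂ ⊛ z ⊕ con 0ℚ)))) refl
    c (M i 0F) (M i 1F) (M i 2F) (v 0F) (v 1F) (v 2F)

module _ {c : ℚ} (c≢0 : c ≢ 0ℚ) (M : Matrix 3) (v : Vector ℚ 3) where

  ⋆-≢0 : ∀ i → (M · v) i ≢ 0ℚ → ((c ⋆ M) · v) i ≢ 0ℚ
  ⋆-≢0 i nz eq = *-≢0 c≢0 nz (trans (sym (⋆-· c M v i)) eq)

  -- Ratios of coordinates are homogeneous of degree 0, so they do not see the rescaling done by
  -- `pad`.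
  ⋆-ratio⁺ : ∀ i j {x} → (M · v) i ≡ (M · v) j * x → ((c ⋆ M) · v) i ≡ ((c ⋆ M) · v) j * x
  ⋆-ratio⁺ i j {x} eq = begin
    ((c ⋆ M) · v) i     ≡⟨ ⋆-· c M v i ⟩
    c * (M · v) i       ≡⟨ cong (c *_) eq ⟩
    c * ((M · v) j * x) ≡⟨ ℚ.*-assoc c _ x ⟨
    c * (M · v) j * x   ≡⟨ cong (_* x) (⋆-· c M v j) ⟨
    ((c ⋆ M) · v) j * x ∎
    where open ≡-Reasoning

  ⋆-ratio⁻ : ∀ i j {x} → ((c ⋆ M) · v) i ≡ ((c ⋆ M) · v) j * x → (M · v) i ≡ (M · v) j * x
  ⋆-ratio⁻ i j {x} eq = *-cancelˡ c≢0 (begin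
    c * (M · v) i       ≡⟨ ⋆-· c M v i ⟨
    ((c ⋆ M) · v) i     ≡⟨ eq ⟩
    ((c ⋆ M) · v) j * x ≡⟨ cong (_* x) (⋆-· c M v j) ⟩
    c * (M · v) j * x   ≡⟨ ℚ.*-assoc c _ x ⟩
    c * ((M · v) j * x) ∎)
    where open ≡-Reasoning

-- The point (1 : l : r) of the projective plane. The free scalar `v 0F` absorbs the factors that
-- successive unnormalised operators accumulate.
record Represents (v : Vector ℚ 3) (l r : ℕ) : Set where
  constructor represents
  field
    nonzero : v 0F ≢ 0ℚ
    left≡   : v 1F ≡ v 0F * ι l
    right≡  : v 2F ≡ v 0F * ι r

-- The linear form with coefficients a, evaluated at (1, l, r).
linear : Vector ℚ 3 → ℕ → ℕ → ℚ
linear a l r = a 0F + (a 1F * ι l + a 2F * ι r)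

·-represents : ∀ (M : Matrix 3) {v l r} → Represents v l r → ∀ i →
               (M · v) i ≡ v 0F * linear (M i) l r
·-represents M {v} {l} {r} (represents _ v₁≡ v₂≡) i rewrite v₁≡ | v₂≡ =
  solve 6 (λ a b c x l r → a ⊛ x ⊕ (b ⊛ (x ⊛ l) ⊕ (c ⊛ (x ⊛ r) ⊕ con 0ℚ)) := x ⊛ (a ⊕ (b ⊛ l ⊕ c ⊛ r)))
    refl (M i 0F) (M i 1F) (M i 2F) (v 0F) (ι l) (ι r)

module _ (M : Matrix 3) {v l r} (rep : Represents v l r) where

  open Represents rep

  ·-≢0 : ∀ i → linear (M i) l r ≢ 0ℚ → (M · v) i ≢ 0ℚ
  ·-≢0 i nz eq = *-≢0 nonzero nz (trans (sym (·-represents M rep i)) eq)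

  ·-ratio⁺ : ∀ i j {x} → linear (M i) l r ≡ linear (M j) l r * x → (M · v) i ≡ (M · v) j * x
  ·-ratio⁺ i j {x} eq = begin
    (M · v) i                        ≡⟨ ·-represents M rep i ⟩
    v 0F * linear (M i) l r          ≡⟨ cong (v 0F *_) eq ⟩
    v 0F * (linear (M j) l r * x)    ≡⟨ ℚ.*-assoc (v 0F) _ x ⟨
    v 0F * linear (M j) l r * x      ≡⟨ cong (_* x) (·-represents M rep j) ⟨
    (M · v) j * x                    ∎
    where open ≡-Reasoning

  ·-ratio⁻ : ∀ i j {x} → (M · v) i ≡ (M · v) j * x → linear (M i) l r ≡ linear (M j) l r * x
  ·-ratio⁻ i j {x} eq = *-cancelˡ nonzero (begin
    v 0F * linear (M i) l r          ≡⟨ ·-represents M rep i ⟨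
    (M · v) i                        ≡⟨ eq ⟩
    (M · v) j * x                    ≡⟨ cong (_* x) (·-represents M rep j) ⟩
    v 0F * linear (M j) l r * x      ≡⟨ ℚ.*-assoc (v 0F) _ x ⟩
    v 0F * (linear (M j) l r * x)    ∎)
    where open ≡-Reasoning

  -- Row 0 may be any nonzero common denominator, which allows division by the base without
  -- fractional entries.
  ⋆-represents : ∀ {c l′ r′} → c ≢ 0ℚ → linear (M 0F) l r ≢ 0ℚ →
                 linear (M 1F) l r ≡ linear (M 0F) l r * ι l′ →
                 linear (M 2F) l r ≡ linear (M 0F) l r * ι r′ →
                 Represents ((c ⋆ M) · v) l′ r′
  ⋆-represents c≢0 nz eqˡ eqʳ =
    represents (⋆-≢0 c≢0 M v 0F (·-≢0 0F nz))
               (⋆-ratio⁺ c≢0 M v 1F 0F (·-ratio⁺ 1F 0F eqˡ))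
               (⋆-ratio⁺ c≢0 M v 2F 0F (·-ratio⁺ 2F 0F eqʳ))

e₀ 0⃗ : Vector ℚ 3
e₀ = ⟪ 1ℚ , 0ℚ , 0ℚ ⟫
0⃗ = ⟪ 0ℚ , 0ℚ , 0ℚ ⟫

linear-scalar : ∀ p l r → linear ⟪ p , 0ℚ , 0ℚ ⟫ l r ≡ p
linear-scalar p l r =
  solve 3 (λ p l r → p ⊕ (con 0ℚ ⊛ l ⊕ con 0ℚ ⊛ r) := p) refl p (ι l) (ι r)

e₀≢0 : ∀ l r → linear e₀ l r ≢ 0ℚ
e₀≢0 l r eq = ℚ.1≢0 (trans (sym (linear-scalar 1ℚ l r)) eq)

-- Coding the tape by two numerals

module Simulation {k : ℕ} (M : TuringMachine k) where

  open TuringMachine M renaming (#states to #q; #extra to g; start to q₀)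
  open TM M

  base : ℕ
  base = suc (k ℕ.+ g)

  Digit : Set
  Digit = Fin base

  -- The blank is digit 0, so blank cells beyond a list leave its numeral unchanged.
  digit : Γ → Digit
  digit blank     = zero
  digit (input a) = suc (a ↑ˡ g)
  digit (extra e) = suc (k ↑ʳ e)

  symbol : Digit → Γ
  symbol zero    = blank
  symbol (suc x) = [ input , extra ]′ (splitAt k x)

  symbol-digit : ∀ a → symbol (digit a) ≡ a
  symbol-digit blank     = refl
  symbol-digit (input a) = cong [ input , extra ]′ (splitAt-↑ˡ k a g)
  symbol-digit (extra e) = cong [ input , extra ]′ (splitAt-↑ʳ k g e)

  push : Digit → ℕ → ℕ
  push x n = toℕ x ℕ.+ base ℕ.* n

  ι-push : ∀ x n → ι (push x n) ≡ ι (toℕ x) + ι base * ι n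
  ι-push x n = trans (ι-+ (toℕ x) (base ℕ.* n)) (cong (ι (toℕ x) +_) (ι-* base n))

  -- The remainder modulo the base recovers the lowest digit. This is why only one guess of a digit
  -- can pass its check.
  push-injective : ∀ {x y m n} → push x m ≡ push y n → x ≡ y
  push-injective {x} {y} {m} {n} eq = toℕ-injective (begin
    toℕ x             ≡⟨ low x m ⟨
    push x m % base   ≡⟨ cong (_% base) eq ⟩
    push y n % base   ≡⟨ low y n ⟩
    toℕ y             ∎)
    where
    open ≡-Reasoning
    low : ∀ x m → push x m % base ≡ toℕ x
    low x m = begin
      (toℕ x ℕ.+ base ℕ.* m) % base ≡⟨ cong (λ n → (toℕ x ℕ.+ n) % base) (ℕ.*-comm base m) ⟩
      (toℕ x ℕ.+ m ℕ.* base) % base ≡⟨ [m+kn]%n≡m%n (toℕ x) m base ⟩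
      toℕ x % base                  ≡⟨ m<n⇒m%n≡m (toℕ<n x) ⟩
      toℕ x                         ∎

  code : List Γ → ℕ
  code []       = 0
  code (a ∷ as) = push (digit a) (code as)

  top : List Γ → Γ
  top []      = blank
  top (a ∷ _) = a

  rest : List Γ → List Γ
  rest []       = []
  rest (_ ∷ as) = as

  -- An empty list stands for an endless run of blanks, and 0 = 0 + base · 0.
  code-top : ∀ as → code as ≡ push (digit (top as)) (code (rest as))
  code-top []       = sym (ℕ.*-zeroʳ base)
  code-top (a ∷ as) = refl

  -- The scanned cell counts as the lowest digit of the right half.
  codeˡ codeʳ : Config → ℕ
  codeˡ (config _ ls _ _)  = code ls
  codeʳ (config _ _ a rs) = code (a ∷ rs)

  Encodes : Vector ℚ 3 → Config → Set
  Encodes v c = Represents v (codeˡ c) (codeʳ c)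

  shift-state : ∀ dir q ls a rs → Config.state (shift dir q ls a rs) ≡ q
  shift-state right q ls       a []      = refl
  shift-state right q ls       a (_ ∷ _) = refl
  shift-state left  q []       a rs      = refl
  shift-state left  q (_ ∷ ls) a rs      = refl

  -- The codes after a move, in a form that needs no case distinction at the ends of the tape.
  shiftˡ shiftʳ : Direction → List Γ → Γ → List Γ → ℕ
  shiftˡ right ls b rs = push (digit b) (code ls)
  shiftˡ left  ls b rs = code (rest ls)
  shiftʳ right ls b rs = code rs
  shiftʳ left  ls b rs = push (digit (top ls)) (push (digit b) (code rs))

  codeˡ-shift : ∀ dir q ls b rs → codeˡ (shift dir q ls b rs) ≡ shiftˡ dir ls b rs
  codeˡ-shift right q ls       b []      = refl
  codeˡ-shift right q ls       b (_ ∷ _) = refl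
  codeˡ-shift left  q []       b rs      = refl
  codeˡ-shift left  q (_ ∷ _)  b rs      = refl

  codeʳ-shift : ∀ dir q ls b rs → codeʳ (shift dir q ls b rs) ≡ shiftʳ dir ls b rs
  -- The head enters a fresh blank, whose numeral is base · 0.
  codeʳ-shift right q ls       b []      = ℕ.*-zeroʳ base
  codeʳ-shift right q ls       b (_ ∷ _) = refl
  codeʳ-shift left  q []       b rs      = refl
  codeʳ-shift left  q (_ ∷ _)  b rs      = refl

  -- Tape operations as matrices

  β : ℚ
  β = ι base

  δ⟨_⟩ : Digit → ℚ
  δ⟨ x ⟩ = ι (toℕ x)

  β-row : Vector ℚ 3
  β-row = ⟪ β , 0ℚ , 0ℚ ⟫

  -- These produce β (1 , n , 0), where r = x + β n, respectively l = y + β n.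
  popʳ popˡ : Digit → Matrix 3
  popʳ x = ⟪ β-row , ⟪ - δ⟨ x ⟩ , 0ℚ , 1ℚ ⟫ , 0⃗ ⟫
  popˡ y = ⟪ β-row , ⟪ - δ⟨ y ⟩ , 1ℚ , 0ℚ ⟫ , 0⃗ ⟫

  -- β (1 , l′ , r′) for the codes l′ and r′ of the tape after writing b and moving.
  move : Direction → (b x y : Digit) → Matrix 3
  move right b x y = ⟪ β-row
                     , ⟪ β * δ⟨ b ⟩ , β * β , 0ℚ ⟫
                     , ⟪ - δ⟨ x ⟩ , 0ℚ , 1ℚ ⟫ ⟫
  move left  b x y = ⟪ β-row
                     , ⟪ - δ⟨ y ⟩ , 1ℚ , 0ℚ ⟫
                     , ⟪ β * (δ⟨ y ⟩ + β * (δ⟨ b ⟩ + - δ⟨ x ⟩)) , 0ℚ , β * β ⟫ ⟫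

  -- The two sides evaluate to r - x and β n; injectivity of `ι` brings the equation back to natural
  -- numbers.
  popʳ-linear : ∀ x l r n → linear (popʳ x 1F) l r ≡ linear β-row l r * ι n ⇔ r ≡ push x n
  popʳ-linear x l r n = mk⇔ to from
    where
    open ≡-Reasoning
    expand : linear (popʳ x 1F) l r ≡ - δ⟨ x ⟩ + ι r
    expand = solve 3 (λ x l r → ⊖ x ⊕ (con 0ℚ ⊛ l ⊕ con 1ℚ ⊛ r) := ⊖ x ⊕ r) refl δ⟨ x ⟩ (ι l) (ι r)
    to : linear (popʳ x 1F) l r ≡ linear β-row l r * ι n → r ≡ push x n
    to eq = ι-injective (begin
      ι r                              ≡⟨ solve 2 (λ x r → r := x ⊕ (⊖ x ⊕ r)) refl δ⟨ x ⟩ (ι r) ⟩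
      δ⟨ x ⟩ + (- δ⟨ x ⟩ + ι r)        ≡⟨ cong (δ⟨ x ⟩ +_) (trans (sym expand) eq) ⟩
      δ⟨ x ⟩ + linear β-row l r * ι n  ≡⟨ cong (λ p → δ⟨ x ⟩ + p * ι n) (linear-scalar β l r) ⟩
      δ⟨ x ⟩ + β * ι n                 ≡⟨ ι-push x n ⟨
      ι (push x n)                     ∎)
    from : r ≡ push x n → linear (popʳ x 1F) l r ≡ linear β-row l r * ι n
    from refl = begin
      linear (popʳ x 1F) l r        ≡⟨ expand ⟩
      - δ⟨ x ⟩ + ι r                ≡⟨ cong (- δ⟨ x ⟩ +_) (ι-push x n) ⟩
      - δ⟨ x ⟩ + (δ⟨ x ⟩ + β * ι n) ≡⟨ solve 2 (λ x y → ⊖ x ⊕ (x ⊕ y) := y) refl δ⟨ x ⟩ (β * ι n) ⟩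
      β * ι n                       ≡⟨ cong (_* ι n) (linear-scalar β l r) ⟨
      linear β-row l r * ι n        ∎

  swap-linear : ∀ a b c l r → linear ⟪ a , b , c ⟫ l r ≡ linear ⟪ a , c , b ⟫ r l
  swap-linear a b c l r = cong (a +_) (ℚ.+-comm (b * ι l) (c * ι r))

  popˡ-linear : ∀ y l r n → linear (popˡ y 1F) l r ≡ linear β-row l r * ι n ⇔ l ≡ push y n
  popˡ-linear y l r n
    -- Exchanging l and r turns the row of `popˡ` into that of `popʳ`.
    rewrite swap-linear (- δ⟨ y ⟩) 1ℚ 0ℚ l r | swap-linear β 0ℚ 0ℚ l r = popʳ-linear y r l n

  β-row≢0 : ∀ l r → linear β-row l r ≢ 0ℚ
  β-row≢0 l r eq = ι-suc≢0 (k ℕ.+ g) (trans (sym (linear-scalar β l r)) eq)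

  move-encodes : ∀ {c v} → c ≢ 0ℚ → ∀ dir q b ls a rs → Represents v (code ls) (code (a ∷ rs)) →
                 Encodes ((c ⋆ move dir (digit b) (digit a) (digit (top ls))) · v) (shift dir q ls b rs)
  move-encodes {c} {v} c≢0 dir q b ls a rs rep
    rewrite codeˡ-shift dir q ls b rs | codeʳ-shift dir q ls b rs = go dir
    where
    open ≡-Reasoning
    l = code ls
    r = code (a ∷ rs)
    x = digit a
    y = digit (top ls)
    go : ∀ dir → Represents ((c ⋆ move dir (digit b) x y) · v) (shiftˡ dir ls b rs) (shiftʳ dir ls b rs)
    go right = ⋆-represents (move right (digit b) x y) rep c≢0 (β-row≢0 l r)
      (begin
        β * δ⟨ digit b ⟩ + (β * β * ι l + 0ℚ * ι r)
          ≡⟨ solve 4 (λ β b l r → β ⊛ b ⊕ (β ⊛ β ⊛ l ⊕ con 0ℚ ⊛ r)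
               := (β ⊕ (con 0ℚ ⊛ l ⊕ con 0ℚ ⊛ r)) ⊛ (b ⊕ β ⊛ l)) refl β δ⟨ digit b ⟩ (ι l) (ι r) ⟩
        linear β-row l r * (δ⟨ digit b ⟩ + β * ι l)
          ≡⟨ cong (linear β-row l r *_) (ι-push (digit b) l) ⟨
        linear β-row l r * ι (push (digit b) l) ∎)
      (Equivalence.from (popʳ-linear x l r (code rs)) refl)
    -- Overwriting the last digit x by b turns r into r + (b - x); pushing y then multiplies by β
    -- and adds y. The matrix holds β times the result.
    go left = ⋆-represents (move left (digit b) x y) rep c≢0 (β-row≢0 l r)
      (Equivalence.from (popˡ-linear y l r (code (rest ls))) (code-top ls))
      (begin
        β * (δ⟨ y ⟩ + β * (δ⟨ digit b ⟩ + - δ⟨ x ⟩)) + (0ℚ * ι l + β * β * ι r)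
          ≡⟨ cong (λ s → β * (δ⟨ y ⟩ + β * (δ⟨ digit b ⟩ + - δ⟨ x ⟩)) + (0ℚ * ι l + β * β * s))
               (ι-push x (code rs)) ⟩
        β * (δ⟨ y ⟩ + β * (δ⟨ digit b ⟩ + - δ⟨ x ⟩)) + (0ℚ * ι l + β * β * (δ⟨ x ⟩ + β * ι (code rs)))
          ≡⟨ solve 6 (λ β y b x l n →
               β ⊛ (y ⊕ β ⊛ (b ⊕ ⊖ x)) ⊕ (con 0ℚ ⊛ l ⊕ β ⊛ β ⊛ (x ⊕ β ⊛ n))
               := β ⊛ (y ⊕ β ⊛ (b ⊕ β ⊛ n))) refl
               β δ⟨ y ⟩ δ⟨ digit b ⟩ δ⟨ x ⟩ (ι l) (ι (code rs)) ⟩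
        β * (δ⟨ y ⟩ + β * (δ⟨ digit b ⟩ + β * ι (code rs)))
          ≡⟨ cong (λ s → β * (δ⟨ y ⟩ + β * s)) (ι-push (digit b) (code rs)) ⟨
        β * (δ⟨ y ⟩ + β * ι (push (digit b) (code rs)))
          ≡⟨ cong (β *_) (ι-push y (push (digit b) (code rs))) ⟨
        β * ι (push y (push (digit b) (code rs)))
          ≡⟨ cong (_* ι (push y (push (digit b) (code rs)))) (linear-scalar β l r) ⟨
        linear β-row l r * ι (push y (push (digit b) (code rs))) ∎)

  -- Control states of the automaton

  data Control : Set where
    read count decrement zero? win lose : Control
    run   : Fin #q → Control
    guess : Fin #q → (x y : Digit) → Control

  #control : ℕ
  #control = 6 ℕ.+ (#q ℕ.+ #q ℕ.* (base ℕ.* base))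

  encode : Control → Fin #control
  encode read          = 0F
  encode count         = 1F
  encode decrement     = 2F
  encode zero?         = 3F
  encode win           = 4F
  encode lose          = 5F
  encode (run q)       = 6 ↑ʳ (q ↑ˡ _)
  encode (guess q x y) = 6 ↑ʳ (#q ↑ʳ combine q (combine x y))

  guess₂ : Fin #q → Fin (base ℕ.* base) → Control
  guess₂ q j = uncurry (guess q) (remQuot base j)

  decode : Fin #control → Control
  decode 0F = read
  decode 1F = count
  decode 2F = decrement
  decode 3F = zero?
  decode 4F = win
  decode 5F = lose
  decode (suc (suc (suc (suc (suc (suc i)))))) with splitAt #q i
  ... | inj₁ q = run q
  ... | inj₂ j = uncurry guess₂ (remQuot (base ℕ.* base) j)

  decode-encode : ∀ a → decode (encode a) ≡ a
  decode-encode read      = refl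
  decode-encode count     = refl
  decode-encode decrement = refl
  decode-encode zero?     = refl
  decode-encode win       = refl
  decode-encode lose      = refl
  decode-encode (run q)
    rewrite splitAt-↑ˡ #q q (#q ℕ.* (base ℕ.* base)) = refl
  decode-encode (guess q x y)
    rewrite splitAt-↑ʳ #q (#q ℕ.* (base ℕ.* base)) (combine q (combine x y)) =
    trans (cong (uncurry guess₂) (remQuot-combine q (combine x y)))
          (cong (uncurry (guess q)) (remQuot-combine x y))

  -- Rules of the automaton

  Target : Symbol k → Set
  Target s = Control × Move s

  Program : Set
  Program = ∀ s → List (Matrix 3 × Target s)

  abstract

    factor filler : ∀ {s} → List (Matrix 3 × Target s) → ℚ
    factor L = Scale.c (total L) (0≤total L)
    filler L = Scale.e (total L) (0≤total L)

    factor≢0 : ∀ {s} (L : List (Matrix 3 × Target s)) → factor L ≢ 0ℚ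
    factor≢0 L = Scale.c≢0 (total L) (0≤total L)

  padded : ∀ {s} → List (Matrix 3 × Target s) → List (Matrix 3 × Target s)
  padded L = pad (win , stay) (factor L) (filler L) L

  abstract

    padded-complete : ∀ {s} (L : List (Matrix 3 × Target s)) i j →
                      sum (λ m → gram (proj₁ (lookup (padded L) m)) i j) ≡ 𝟙 i j
    padded-complete L i j = begin
      sum (λ m → gram (proj₁ (lookup (padded L) m)) i j) ≡⟨ pad-gram (win , stay) c e L i j ⟩
      (c * c * total L + e * e) * 𝟙 i j                  ≡⟨ cong (_* 𝟙 i j) c²t+e²≡1 ⟩
      1ℚ * 𝟙 i j                                         ≡⟨ ℚ.*-identityˡ (𝟙 i j) ⟩
      𝟙 i j                                              ∎
      where
      open ≡-Reasoning
      open Scale (total L) (0≤total L)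

  branches : ∀ {s} → List (Matrix 3 × Target s) → Branches #control s
  branches L = record
    { size   = length (padded L)
    ; branch = λ j → map₁ encode (proj₂ (lookup (padded L) j))
    }

  superoperator : ∀ {s} (L : List (Matrix 3 × Target s)) → Superoperator 3 (Branches.size (branches L))
  superoperator L = record
    { op       = λ j → proj₁ (lookup (padded L) j)
    ; complete = padded-complete L
    }

  choose : ∀ n → (Fin n → Control) → StateRule k #control 3
  choose n f = existential (λ _ → record { size = n ; branch = λ j → encode (f j) , stay })

  perform : Program → StateRule k #control 3
  perform L = universal (λ s → branches (L s) , superoperator (L s))

  -- While the input is read, the register is a multiple of (1 , βⁿ , r), where
  -- r codes the n letters read so far.
  readMatrix : Symbol k → Matrix 3
  readMatrix ⊢          = 𝟙
  readMatrix ⊣          = ⟪ e₀ , 0⃗ , ⟪ 0ℚ , 0ℚ , 1ℚ ⟫ ⟫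
  readMatrix (letter a) = ⟪ e₀ , ⟪ 0ℚ , β , 0ℚ ⟫ , ⟪ 0ℚ , δ⟨ digit (input a) ⟩ , 1ℚ ⟫ ⟫

  readTarget : ∀ s → Target s
  readTarget ⊢          = read , forward (λ ())
  readTarget ⊣          = run q₀ , stay
  readTarget (letter _) = read , forward (λ ())

  -- The first lowers the ratio of coordinate 1 to coordinate 0 by one. The second keeps coordinate
  -- 1 alone, so its branch exists iff that coordinate is nonzero.
  decrementMatrix testMatrix : Matrix 3
  decrementMatrix = ⟪ e₀ , ⟪ - 1ℚ , 1ℚ , 0ℚ ⟫ , 0⃗ ⟫
  testMatrix      = ⟪ ⟪ 0ℚ , 1ℚ , 0ℚ ⟫ , 0⃗ , 0⃗ ⟫

  moveMatrix : Fin #q → Digit → Digit → Matrix 3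
  moveMatrix q x y = let (_ , b , dir) = δ q (symbol x) in move dir (digit b) x y

  readProgram decrementProgram zero?Program : Program
  readProgram s      = (readMatrix s , readTarget s) ∷ []
  decrementProgram _ = (decrementMatrix , count , stay) ∷ []
  zero?Program _     = (testMatrix , lose , stay) ∷ []

  -- All three branches must accept: two verify the guessed digits and the third continues the run.
  -- Each gets its own image of the register, so the checks do not disturb the run.
  guessProgram : Fin #q → Digit → Digit → Program
  guessProgram q x y _ = (popʳ x , count , stay)
                       ∷ (popˡ y , count , stay)
                       ∷ (moveMatrix q x y , run (proj₁ (δ q (symbol x))) , stay)
                       ∷ []

  -- The decisions are arguments so that proofs can match on them directly.
  runRule : ∀ {q} → Dec (q ≡ accept) → Dec (q ≡ reject) → StateRule k #control 3
  runRule         (yes _) _       = accepting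
  runRule         (no _)  (yes _) = rejecting
  runRule {q = q} (no _)  (no _)  = choose (base ℕ.* base) (guess₂ q)

  ruleOf : Control → StateRule k #control 3
  ruleOf read          = perform readProgram
  ruleOf count         = choose 2 λ { 0F → zero? ; 1F → decrement }
  ruleOf decrement     = perform decrementProgram
  ruleOf zero?         = perform zero?Program
  ruleOf win           = accepting
  ruleOf lose          = rejecting
  ruleOf (run q)       = runRule (q ≟ accept) (q ≟ reject)
  ruleOf (guess q x y) = perform (guessProgram q x y)

  automaton : Q1AFA k
  automaton = record
    { #states   = #control
    ; dim       = 3
    ; start     = encode read
    -- The empty prefix: β⁰ = 1 in coordinate 1, and numeral 0 in coordinate 2.
    ; start-ket = ket ⟪ 1ℚ , 1ℚ , 0ℚ ⟫ (0<⟨v∣v⟩ ⟪ 1ℚ , 1ℚ , 0ℚ ⟫ 0F λ ())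
    ; rule      = λ i → ruleOf (decode i)
    }

  rule-encode : ∀ a → Q1AFA.rule automaton (encode a) ≡ ruleOf a
  rule-encode a = cong ruleOf (decode-encode a)

  -- Accepting subtrees of the automaton

  module Run (w : List (Fin k)) where

    open QA automaton w using (AcceptingSubtree; leaf; ∃-node; ∀-node)

    Accepting : Control → ℕ → Ket 3 → Set
    Accepting a i ψ = AcceptingSubtree (QA.config (encode a) i , ψ)

    -- Conditional on the branch existing, hence vacuous for a branch of probability 0.
    Reaches : ∀ {s} → ℚ → Matrix 3 × Target s → ℕ → Ket 3 → Set
    Reaches c (E , a , mv) i ψ =
      (p : 0ℚ < prob (c ⋆ E) ψ) → Accepting a (advance mv i) (collapse (c ⋆ E) ψ p)

    win-accepting : ∀ {i ψ} → Accepting win i ψ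
    win-accepting = leaf refl

    -- The fillers lead to `win`, so only the listed matrices leave obligations.
    perform-accepting : ∀ {a L i ψ} s → ruleOf a ≡ perform L → scan w i ≡ s →
                        All (λ B → Reaches (factor (L s)) B i ψ) (L s) → Accepting a i ψ
    perform-accepting {a} {L} {i} {ψ} s eq refl reach =
      ∀-node (trans (rule-encode a) eq) refl
        (λ j p → All.lookup
          (pad-All (win , stay) {P} (factor (L s)) (filler (L s)) (L s) (λ _ _ → win-accepting) reach)
          (∈-lookup j) p)
      where
      P : Matrix 3 × Target s → Set
      P (E , a , mv) = (p : 0ℚ < prob E ψ) → Accepting a (advance mv i) (collapse E ψ p)

    -- Counting down to zero

    decrement-ratio : ∀ v {x} →
      (decrementMatrix · v) 1F ≡ (decrementMatrix · v) 0F * x ⇔ v 1F ≡ v 0F * (1ℚ + x)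
    decrement-ratio v {x} = mk⇔
      (λ eq → begin
        v 1F
          ≡⟨ solve 3 (λ a b c →
               b := a ⊕ (con (- 1ℚ) ⊛ a ⊕ (con 1ℚ ⊛ b ⊕ (con 0ℚ ⊛ c ⊕ con 0ℚ))))
               refl (v 0F) (v 1F) (v 2F) ⟩
        v 0F + (decrementMatrix · v) 1F
          ≡⟨ cong (v 0F +_) eq ⟩
        v 0F + (decrementMatrix · v) 0F * x
          ≡⟨ solve 4 (λ a b c x →
               a ⊕ (con 1ℚ ⊛ a ⊕ (con 0ℚ ⊛ b ⊕ (con 0ℚ ⊛ c ⊕ con 0ℚ))) ⊛ x
               := a ⊛ (con 1ℚ ⊕ x))
               refl (v 0F) (v 1F) (v 2F) x ⟩
        v 0F * (1ℚ + x) ∎)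
      (λ eq → begin
        - 1ℚ * v 0F + (1ℚ * v 1F + (0ℚ * v 2F + 0ℚ))
          ≡⟨ cong (λ b → - 1ℚ * v 0F + (1ℚ * b + (0ℚ * v 2F + 0ℚ))) eq ⟩
        - 1ℚ * v 0F + (1ℚ * (v 0F * (1ℚ + x)) + (0ℚ * v 2F + 0ℚ))
          ≡⟨ solve 4 (λ a b c x →
               con (- 1ℚ) ⊛ a ⊕ (con 1ℚ ⊛ (a ⊛ (con 1ℚ ⊕ x)) ⊕ (con 0ℚ ⊛ c ⊕ con 0ℚ))
               := (con 1ℚ ⊛ a ⊕ (con 0ℚ ⊛ b ⊕ (con 0ℚ ⊛ c ⊕ con 0ℚ))) ⊛ x)
               refl (v 0F) (v 1F) (v 2F) x ⟩
        (decrementMatrix · v) 0F * x ∎)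
      where open ≡-Reasoning

    zero?-vanishes : ∀ c v → v 1F ≡ 0ℚ → ∀ i → ((c ⋆ testMatrix) · v) i ≡ 0ℚ
    zero?-vanishes c v v₁≡0 i =
      trans (⋆-· c testMatrix v i) (trans (cong (c *_) (vanishes i)) (ℚ.*-zeroʳ c))
      where
      zeros = solve 3 (λ x y z → con 0ℚ ⊛ x ⊕ (con 0ℚ ⊛ y ⊕ (con 0ℚ ⊛ z ⊕ con 0ℚ)) := con 0ℚ)
                refl (v 0F) (v 1F) (v 2F)
      vanishes : ∀ i → (testMatrix · v) i ≡ 0ℚ
      vanishes 0F rewrite v₁≡0 =
        solve 2 (λ x z → con 0ℚ ⊛ x ⊕ (con 1ℚ ⊛ con 0ℚ ⊕ (con 0ℚ ⊛ z ⊕ con 0ℚ)) := con 0ℚ)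
          refl (v 0F) (v 2F)
      vanishes 1F = zeros
      vanishes 2F = zeros

    -- The strategy is to decrement n times and then test; at zero the branch into `lose` does not
    -- exist.
    count-accepting : ∀ n {i ψ} → let v = Ket.vec ψ in v 1F ≡ v 0F * ι n → Accepting count i ψ
    count-accepting zero {i} {ψ} eq = ∃-node refl 0F
      (perform-accepting {zero?} {zero?Program} _ refl refl
        ((λ p → contradiction p (prob≯0 (c ⋆ testMatrix) ψ
          (zero?-vanishes c v (trans eq (ℚ.*-zeroʳ (v 0F)))))) ∷ []))
      where
      v = Ket.vec ψ
      c = factor (zero?Program (scan w i))
    count-accepting (suc n) {i} {ψ} eq = ∃-node refl 1F
      (perform-accepting {decrement} {decrementProgram} _ refl refl
        ((λ p → count-accepting n (⋆-ratio⁺ (factor≢0 (decrementProgram (scan w i))) decrementMatrix v 1F 0F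
          (Equivalence.from (decrement-ratio v) eq))) ∷ []))
      where v = Ket.vec ψ

    lose-sound : ∀ {i ψ} → ¬ Accepting lose i ψ
    lose-sound (leaf ())

    testMatrix-· : ∀ v → (testMatrix · v) 0F ≡ v 1F
    testMatrix-· v = solve 3 (λ x y z → con 0ℚ ⊛ x ⊕ (con 1ℚ ⊛ y ⊕ (con 0ℚ ⊛ z ⊕ con 0ℚ)) := y)
                       refl (v 0F) (v 1F) (v 2F)

    -- Were coordinate 1 nonzero, the branch into `lose` would exist and would have to accept.
    zero?-sound : ∀ {i ψ} → Accepting zero? i ψ → Ket.vec ψ 1F ≡ 0ℚ
    zero?-sound {i} {ψ} (∀-node refl refl f) = decidable-stable (v 1F ℚ.≟ 0ℚ) λ v₁≢0 →
      lose-sound (f zero (0<prob (c ⋆ testMatrix) ψ 0F (⋆-≢0 c≢0 testMatrix v 0F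
        λ eq → v₁≢0 (trans (sym (testMatrix-· v)) eq))))
      where
      v = Ket.vec ψ
      c = factor (zero?Program (scan w i))
      c≢0 = factor≢0 (zero?Program (scan w i))

    module _ (c : ℚ) (c≢0 : c ≢ 0ℚ) (v : Vector ℚ 3) where

      decrement-≢0 : v 0F ≢ 0ℚ → ((c ⋆ decrementMatrix) · v) 0F ≢ 0ℚ
      decrement-≢0 v₀≢0 = ⋆-≢0 c≢0 decrementMatrix v 0F λ eq → v₀≢0 (trans
        (solve 3 (λ x y z → x := con 1ℚ ⊛ x ⊕ (con 0ℚ ⊛ y ⊕ (con 0ℚ ⊛ z ⊕ con 0ℚ)))
           refl (v 0F) (v 1F) (v 2F)) eq)

      decrement-ratio⁻ : ∃[ n ] ((c ⋆ decrementMatrix) · v) 1F ≡ ((c ⋆ decrementMatrix) · v) 0F * ι n →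
                         ∃[ n ] v 1F ≡ v 0F * ι n
      decrement-ratio⁻ (n , eq) =
        suc n , Equivalence.to (decrement-ratio v) (⋆-ratio⁻ c≢0 decrementMatrix v 1F 0F eq)

    -- Induction on the subtree: being finite, it contains finitely many decrements before the zero
    -- test, and their number is n. As `v 0F` stays nonzero, every decrement branch exists.
    count-sound : ∀ {i ψ} → Ket.vec ψ 0F ≢ 0ℚ → Accepting count i ψ →
                  ∃[ n ] Ket.vec ψ 1F ≡ Ket.vec ψ 0F * ι n
    count-sound {ψ = ψ} v₀≢0 (∃-node refl 0F t) = 0 , trans (zero?-sound t) (sym (ℚ.*-zeroʳ (Ket.vec ψ 0F)))
    count-sound {i} {ψ} v₀≢0 (∃-node refl 1F (∀-node refl refl f)) =
      decrement-ratio⁻ c c≢0 (Ket.vec ψ) (count-sound cMv₀≢0 (f zero (0<prob (c ⋆ decrementMatrix) ψ 0F cMv₀≢0)))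
      where
      c = factor (decrementProgram (scan w i))
      c≢0 = factor≢0 (decrementProgram (scan w i))
      cMv₀≢0 = decrement-≢0 c c≢0 (Ket.vec ψ) v₀≢0

    -- Verification of guessed digits

    module _ (c : ℚ) (c≢0 : c ≢ 0ℚ) (v : Vector ℚ 3) {l r : ℕ} (rep : Represents v l r) where

      -- Ensures that the digit checks exist as branches and cannot be passed vacuously.
      β-row-·≢0 : ∀ u₁ u₂ → ((c ⋆ ⟪ β-row , u₁ , u₂ ⟫) · v) 0F ≢ 0ℚ
      β-row-·≢0 u₁ u₂ = ⋆-≢0 c≢0 ⟪ β-row , u₁ , u₂ ⟫ v 0F (·-≢0 ⟪ β-row , u₁ , u₂ ⟫ rep 0F (β-row≢0 l r))

      popʳ-ratio : ∀ x n → ((c ⋆ popʳ x) · v) 1F ≡ ((c ⋆ popʳ x) · v) 0F * ι n ⇔ r ≡ push x n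
      popʳ-ratio x n = mk⇔
        (λ eq → Equivalence.to (popʳ-linear x l r n)
          (·-ratio⁻ (popʳ x) rep 1F 0F (⋆-ratio⁻ c≢0 (popʳ x) v 1F 0F eq)))
        (λ eq → ⋆-ratio⁺ c≢0 (popʳ x) v 1F 0F
          (·-ratio⁺ (popʳ x) rep 1F 0F (Equivalence.from (popʳ-linear x l r n) eq)))

      popˡ-ratio : ∀ y n → ((c ⋆ popˡ y) · v) 1F ≡ ((c ⋆ popˡ y) · v) 0F * ι n ⇔ l ≡ push y n
      popˡ-ratio y n = mk⇔
        (λ eq → Equivalence.to (popˡ-linear y l r n)
          (·-ratio⁻ (popˡ y) rep 1F 0F (⋆-ratio⁻ c≢0 (popˡ y) v 1F 0F eq)))
        (λ eq → ⋆-ratio⁺ c≢0 (popˡ y) v 1F 0F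
          (·-ratio⁺ (popˡ y) rep 1F 0F (Equivalence.from (popˡ-linear y l r n) eq)))

      popʳ-digit : ∀ {x a as} → r ≡ code (a ∷ as) →
                   ∃[ n ] ((c ⋆ popʳ x) · v) 1F ≡ ((c ⋆ popʳ x) · v) 0F * ι n → x ≡ digit a
      popʳ-digit {x} {a} {as} r≡ (n , eq) =
        push-injective {x} {digit a} {n} {code as} (trans (sym (Equivalence.to (popʳ-ratio x n) eq)) r≡)

      popˡ-digit : ∀ {y as} → l ≡ code as →
                   ∃[ n ] ((c ⋆ popˡ y) · v) 1F ≡ ((c ⋆ popˡ y) · v) 0F * ι n → y ≡ digit (top as)
      popˡ-digit {y} {as} l≡ (n , eq) =
        push-injective {y} {digit (top as)} {n} {code (rest as)}
          (trans (sym (Equivalence.to (popˡ-ratio y n) eq)) (trans l≡ (code-top as)))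

    moveMatrix-encodes : ∀ {c v} → c ≢ 0ℚ → ∀ q ls a rs {x y} → x ≡ digit a → y ≡ digit (top ls) →
                         Encodes v (config q ls a rs) →
                         Encodes ((c ⋆ moveMatrix q x y) · v) (next (config q ls a rs))
    moveMatrix-encodes c≢0 q ls a rs refl refl rep rewrite symbol-digit a =
      let (q′ , b , dir) = δ q a in move-encodes c≢0 dir q′ b ls a rs rep

    next-state : ∀ q ls a rs {x} → x ≡ digit a →
                 Config.state (next (config q ls a rs)) ≡ proj₁ (δ q (symbol x))
    next-state q ls a rs refl rewrite symbol-digit a =
      let (q′ , b , dir) = δ q a in shift-state dir q′ ls b rs

    -- Simulating the run of the Turing machine

    Halts : Config → Set
    Halts c = ∃[ c′ ] Star _⟶_ c c′ × Config.state c′ ≡ accept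

    -- Induction on the run; the strategy always guesses the digits that are on the tape.
    run-accepting : ∀ {c c′ i ψ} → Star _⟶_ c c′ → Config.state c′ ≡ accept →
                    Encodes (Ket.vec ψ) c → Accepting (run (Config.state c)) i ψ
    run-accepting {c} ε eq rep = leaf (trans (rule-encode (run (Config.state c))) run-accept)
      where
      run-accept : ruleOf (run (Config.state c)) ≡ accepting
      run-accept with Config.state c ≟ accept
      ... | yes _  = refl
      ... | no  ne = contradiction eq ne
    run-accepting {config q ls a rs} {i = i} {ψ} (step ≢accept ≢reject ◅ steps) eq rep =
      ∃-node (trans (rule-encode (run q)) run-choose) (combine x y)
        (subst (λ b → Accepting b i ψ) (sym (cong (uncurry (guess q)) (remQuot-combine x y)))
          (perform-accepting {guess q x y} {guessProgram q x y} _ refl refl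
            ( (λ p → count-accepting (code rs) (Equivalence.from (popʳ-ratio c c≢0 v rep x (code rs)) refl))
            ∷ (λ p → count-accepting (code (rest ls))
                       (Equivalence.from (popˡ-ratio c c≢0 v rep y (code (rest ls))) (code-top ls)))
            ∷ (λ p → subst (λ q′ → Accepting (run q′) i (collapse (c ⋆ moveMatrix q x y) ψ p))
                       (next-state q ls a rs refl)
                       (run-accepting steps eq (moveMatrix-encodes c≢0 q ls a rs refl refl rep)))
            ∷ [])))
      where
      x = digit a
      y = digit (top ls)
      v = Ket.vec ψ
      c = factor (guessProgram q x y (scan w i))
      c≢0 = factor≢0 (guessProgram q x y (scan w i))
      run-choose : ruleOf (run q) ≡ choose (base ℕ.* base) (guess₂ q)
      run-choose with q ≟ accept | q ≟ reject
      ... | yes q≡ | _      = contradiction q≡ ≢accept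
      ... | no _   | yes q≡ = contradiction q≡ ≢reject
      ... | no _   | no _   = refl

    continue : ∀ q ls a rs → q ≢ accept → q ≢ reject →
               Halts (next (config q ls a rs)) → Halts (config q ls a rs)
    continue q ls a rs ≢accept ≢reject (c′ , steps , eq) = c′ , step ≢accept ≢reject ◅ steps , eq

    guess-digits : ∀ {c i ψ} q ls a rs x y → c ≢ 0ℚ → Encodes (Ket.vec ψ) (config q ls a rs) →
                   Reaches {scan w i} c (popʳ x , count , stay) i ψ →
                   Reaches {scan w i} c (popˡ y , count , stay) i ψ →
                   x ≡ digit a × y ≡ digit (top ls)
    guess-digits {c} {i} {ψ} q ls a rs x y c≢0 rep reachʳ reachˡ =
      popʳ-digit c c≢0 v rep {x} {a} {rs} refl
        (count-sound popʳ≢0 (reachʳ (0<prob (c ⋆ popʳ x) ψ 0F popʳ≢0))) ,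
      popˡ-digit c c≢0 v rep {y} {ls} refl
        (count-sound popˡ≢0 (reachˡ (0<prob (c ⋆ popˡ y) ψ 0F popˡ≢0)))
      where
      v = Ket.vec ψ
      popʳ≢0 = β-row-·≢0 c c≢0 v rep (popʳ x 1F) 0⃗
      popˡ≢0 = β-row-·≢0 c c≢0 v rep (popˡ y 1F) 0⃗

    mutual

      -- Recursion on the subtree. The state is a separate index because the automaton computes it
      -- from the guessed digit, which must first be shown correct.
      run-sound : ∀ c {q i ψ} → Config.state c ≡ q → Encodes (Ket.vec ψ) c → Accepting (run q) i ψ → Halts c
      run-sound c@(config q ls a rs) refl rep (leaf eq) with q ≟ accept | q ≟ reject | rule-encode (run q)
      ... | yes q≡accept | _     | _  = c , ε , q≡accept
      ... | no _         | yes _ | re with () ← trans (sym re) eq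
      ... | no _         | no _  | re with () ← trans (sym re) eq
      run-sound c@(config q ls a rs) refl rep (∀-node eq _ _) with q ≟ accept | q ≟ reject | rule-encode (run q)
      ... | yes q≡accept | _     | _  = c , ε , q≡accept
      ... | no _         | yes _ | re with () ← trans (sym re) eq
      ... | no _         | no _  | re with () ← trans (sym re) eq
      run-sound c@(config q ls a rs) refl rep (∃-node eq j t) =
        run-sound-∃ q ls a rs (q ≟ accept) (q ≟ reject) (trans (sym (rule-encode (run q))) eq) rep j t

      run-sound-∃ : ∀ q ls a rs {δ i ψ} (acc? : Dec (q ≡ accept)) (rej? : Dec (q ≡ reject)) →
                    runRule acc? rej? ≡ existential δ → Encodes (Ket.vec ψ) (config q ls a rs) →
                    (j : Fin (Branches.size (δ (scan w i)))) →
                    AcceptingSubtree (QA.successor automaton w i (δ (scan w i)) j , ψ) →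
                    Halts (config q ls a rs)
      run-sound-∃ q ls a rs (no ≢accept) (no ≢reject) refl rep j t =
        let (x , y) = remQuot base j in guess-sound q ls a rs x y ≢accept ≢reject rep t

      guess-sound : ∀ q ls a rs x y {i ψ} → q ≢ accept → q ≢ reject →
                    Encodes (Ket.vec ψ) (config q ls a rs) →
                    Accepting (guess q x y) i ψ → Halts (config q ls a rs)
      guess-sound q ls a rs x y ≢accept ≢reject rep (leaf eq)
        with () ← trans (sym (rule-encode (guess q x y))) eq
      guess-sound q ls a rs x y ≢accept ≢reject rep (∃-node eq _ _)
        with () ← trans (sym (rule-encode (guess q x y))) eq
      guess-sound q ls a rs x y {ψ = ψ} ≢accept ≢reject rep (∀-node eq eq′ f) =
        guess-sound-∀ q ls a rs x y {ψ = ψ} (trans (sym (rule-encode (guess q x y))) eq) eq′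
          ≢accept ≢reject rep f

      -- Generalised over the rule so that both equations can be matched with `refl`. The checks
      -- yield the true digits, and then the third branch encodes the next configuration.
      guess-sound-∀ : ∀ q ls a rs x y {δ i ψ b} {ℰ : Superoperator 3 (Branches.size b)} →
                      perform (guessProgram q x y) ≡ universal δ → δ (scan w i) ≡ (b , ℰ) →
                      q ≢ accept → q ≢ reject → Encodes (Ket.vec ψ) (config q ls a rs) →
                      (∀ j → let E = Superoperator.op ℰ j in (p : 0ℚ < prob E ψ) →
                         AcceptingSubtree (QA.successor automaton w i b j , collapse E ψ p)) →
                      Halts (config q ls a rs)
      -- `pad` puts three fillers after each branch, hence the indices 0, 4 and 8.
      guess-sound-∀ q ls a rs x y {i = i} {ψ} refl refl ≢accept ≢reject rep f =
        continue q ls a rs ≢accept ≢reject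
          (run-sound (next (config q ls a rs)) (next-state q ls a rs (proj₁ digits)) rep′
            (f 8F (0<prob (c ⋆ moveMatrix q x y) ψ 0F (Represents.nonzero rep′))))
        where
        c = factor (guessProgram q x y (scan w i))
        c≢0 = factor≢0 (guessProgram q x y (scan w i))
        digits = guess-digits {i = i} {ψ} q ls a rs x y c≢0 rep (f 0F) (f 4F)
        rep′ = moveMatrix-encodes c≢0 q ls a rs (proj₁ digits) (proj₂ digits) rep

    -- Reading the input

    read-letter : ∀ {c v p r} → c ≢ 0ℚ → ∀ a → Represents v p r →
                  Represents ((c ⋆ readMatrix (letter a)) · v)
                             (base ℕ.* p) (r ℕ.+ toℕ (digit (input a)) ℕ.* p)
    read-letter {p = p} {r} c≢0 a rep = ⋆-represents (readMatrix (letter a)) rep c≢0 (e₀≢0 p r)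
      (begin
        0ℚ + (β * ι p + 0ℚ * ι r)
          ≡⟨ solve 3 (λ β p r → con 0ℚ ⊕ (β ⊛ p ⊕ con 0ℚ ⊛ r)
               := (con 1ℚ ⊕ (con 0ℚ ⊛ p ⊕ con 0ℚ ⊛ r)) ⊛ (β ⊛ p)) refl β (ι p) (ι r) ⟩
        linear e₀ p r * (β * ι p)
          ≡⟨ cong (linear e₀ p r *_) (ι-* base p) ⟨
        linear e₀ p r * ι (base ℕ.* p) ∎)
      (begin
        0ℚ + (δ⟨ digit (input a) ⟩ * ι p + 1ℚ * ι r)
          ≡⟨ solve 3 (λ d p r → con 0ℚ ⊕ (d ⊛ p ⊕ con 1ℚ ⊛ r)
               := (con 1ℚ ⊕ (con 0ℚ ⊛ p ⊕ con 0ℚ ⊛ r)) ⊛ (r ⊕ d ⊛ p)) refl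
               δ⟨ digit (input a) ⟩ (ι p) (ι r) ⟩
        linear e₀ p r * (ι r + δ⟨ digit (input a) ⟩ * ι p)
          ≡⟨ cong (linear e₀ p r *_) (trans (ι-+ r (d ℕ.* p)) (cong (ι r +_) (ι-* d p))) ⟨
        linear e₀ p r * ι (r ℕ.+ d ℕ.* p) ∎)
      where
      open ≡-Reasoning
      d = toℕ (digit (input a))

    read-⊢ : ∀ {c v p r} → c ≢ 0ℚ → Represents v p r → Represents ((c ⋆ readMatrix ⊢) · v) p r
    read-⊢ {p = p} {r} c≢0 rep = ⋆-represents (readMatrix ⊢) rep c≢0
      (e₀≢0 p r)
      (solve 2 (λ p r → con 0ℚ ⊕ (con 1ℚ ⊛ p ⊕ con 0ℚ ⊛ r)
         := (con 1ℚ ⊕ (con 0ℚ ⊛ p ⊕ con 0ℚ ⊛ r)) ⊛ p) refl (ι p) (ι r))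
      (solve 2 (λ p r → con 0ℚ ⊕ (con 0ℚ ⊛ p ⊕ con 1ℚ ⊛ r)
         := (con 1ℚ ⊕ (con 0ℚ ⊛ p ⊕ con 0ℚ ⊛ r)) ⊛ r) refl (ι p) (ι r))

    -- The power of β is erased, leaving 0, the code of an empty left half.
    read-⊣ : ∀ {c v p r} → c ≢ 0ℚ → Represents v p r → Represents ((c ⋆ readMatrix ⊣) · v) 0 r
    read-⊣ {p = p} {r} c≢0 rep = ⋆-represents (readMatrix ⊣) rep c≢0
      (e₀≢0 p r)
      (solve 2 (λ p r → con 0ℚ ⊕ (con 0ℚ ⊛ p ⊕ con 0ℚ ⊛ r)
         := (con 1ℚ ⊕ (con 0ℚ ⊛ p ⊕ con 0ℚ ⊛ r)) ⊛ con 0ℚ) refl (ι p) (ι r))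
      (solve 2 (λ p r → con 0ℚ ⊕ (con 0ℚ ⊛ p ⊕ con 1ℚ ⊛ r)
         := (con 1ℚ ⊕ (con 0ℚ ⊛ p ⊕ con 0ℚ ⊛ r)) ⊛ r) refl (ι p) (ι r))

    readFactor : Symbol k → ℚ
    readFactor s = factor (readProgram s)

    readFactor≢0 : ∀ s → readFactor s ≢ 0ℚ
    readFactor≢0 s = factor≢0 (readProgram s)

    read-accepting : ∀ {i ψ} s → scan w i ≡ s → Reaches (readFactor s) (readMatrix s , readTarget s) i ψ →
                     Accepting read i ψ
    read-accepting s scan≡ reach = perform-accepting {read} {readProgram} s refl scan≡ (reach ∷ [])

    read-sound : ∀ {i ψ} s → scan w i ≡ s → Accepting read i ψ →
                 Reaches (readFactor s) (readMatrix s , readTarget s) i ψ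
    read-sound s refl (∀-node refl refl f) = f 0F

    -- The unread suffix at position i, with the end marker included through `letterAt`.
    Remaining : ℕ → List (Fin k) → Set
    Remaining i u = ∀ n → scan w (i ℕ.+ n) ≡ letterAt u n

    scan-next : ∀ i u → Remaining i u → scan w i ≡ letterAt u 0
    scan-next i u rem = trans (cong (scan w) (sym (ℕ.+-identityʳ i))) (rem 0)

    Remaining-suc : ∀ i a u → Remaining i (a ∷ u) → Remaining (suc i) u
    Remaining-suc i a u rem n = trans (cong (scan w) (sym (ℕ.+-suc i n))) (rem (suc n))

    word : List (Fin k) → ℕ
    word u = code (map input u)

    word-[] : ∀ r p → r ≡ r ℕ.+ p ℕ.* word []
    word-[] r p = sym (trans (cong (r ℕ.+_) (ℕ.*-zeroʳ p)) (ℕ.+-identityʳ r))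

    -- The first letter is the lowest digit, so each new one enters with weight p; r + p · `word` of
    -- the unread suffix is invariant.
    word-∷ : ∀ r p a u → (r ℕ.+ toℕ (digit (input a)) ℕ.* p) ℕ.+ (base ℕ.* p) ℕ.* word u
                         ≡ r ℕ.+ p ℕ.* word (a ∷ u)
    word-∷ r p a u = ℕS.solve 5
      (λ r d p b n → (r ℕS.:+ d ℕS.:* p) ℕS.:+ (b ℕS.:* p) ℕS.:* n
                     ℕS.:= r ℕS.:+ p ℕS.:* (d ℕS.:+ b ℕS.:* n)) refl
      r (toℕ (digit (input a))) p base (word u)

    -- The subtree of the run hangs below that of the reading phase, so it enters as a continuation,
    -- for any register with the right codes.
    word-accepting : ∀ u {i ψ p r} → Remaining i u → Represents (Ket.vec ψ) p r →
      (∀ {j ψ′} → Represents (Ket.vec ψ′) 0 (r ℕ.+ p ℕ.* word u) → Accepting (run q₀) j ψ′) →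
      Accepting read i ψ
    word-accepting [] {i} {p = p} {r} rem rep run-acc = read-accepting ⊣ (scan-next i [] rem) λ _ →
      run-acc (subst (Represents _ 0) (word-[] r p) (read-⊣ (readFactor≢0 ⊣) rep))
    word-accepting (a ∷ u) {i} {p = p} {r} rem rep run-acc =
      read-accepting (letter a) (scan-next i (a ∷ u) rem) λ _ →
        word-accepting u (Remaining-suc i a u rem) (read-letter (readFactor≢0 (letter a)) a rep)
          λ rep′ → run-acc (subst (Represents _ 0) (word-∷ r p a u) rep′)

    word-sound : ∀ u {i ψ p r} → Remaining i u → Represents (Ket.vec ψ) p r → Accepting read i ψ →
      ∃[ j ] ∃[ ψ′ ] Represents (Ket.vec ψ′) 0 (r ℕ.+ p ℕ.* word u) × Accepting (run q₀) j ψ′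
    word-sound [] {i} {ψ} {p} {r} rem rep t =
      let rep′ = read-⊣ (readFactor≢0 ⊣) rep
      in _ , _ , subst (Represents _ 0) (word-[] r p) rep′ ,
         read-sound ⊣ (scan-next i [] rem) t (0<prob (readFactor ⊣ ⋆ readMatrix ⊣) ψ 0F (Represents.nonzero rep′))
    word-sound (a ∷ u) {i} {ψ} {p} {r} rem rep t =
      let rep′ = read-letter (readFactor≢0 (letter a)) a rep
          j , ψ′ , rep″ , t′ = word-sound u (Remaining-suc i a u rem) rep′
            (read-sound (letter a) (scan-next i (a ∷ u) rem) t
              (0<prob (readFactor (letter a) ⋆ readMatrix (letter a)) ψ 0F (Represents.nonzero rep′)))
      in j , ψ′ , subst (Represents _ 0) (word-∷ r p a u) rep″ , t′

    -- Equivalence of the two notions of acceptance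

    start-represents : Represents (Ket.vec (Q1AFA.start-ket automaton)) 1 0
    start-represents = represents (λ ()) refl refl

    initial-state : ∀ u → Config.state (initial u) ≡ q₀
    initial-state []      = refl
    initial-state (_ ∷ _) = refl

    initial-encodes : ∀ u {v} → Represents v 0 (0 ℕ.+ 1 ℕ.* word u) → Encodes v (initial u)
    -- On the empty word the head scans a blank, whose code is base · 0.
    initial-encodes [] {v} rep      = subst (Represents v 0) (sym (ℕ.*-zeroʳ base)) rep
    initial-encodes (a ∷ u) {v} rep = subst (Represents v 0) (ℕ.*-identityˡ (word (a ∷ u))) rep

    simulates : TM.Accepts M w → QA.Accepts automaton w
    simulates (c , steps , eq) =
      read-accepting {ψ = Q1AFA.start-ket automaton} ⊢ refl λ _ →
        word-accepting w (λ _ → refl) (read-⊢ (readFactor≢0 ⊢) start-represents) λ rep →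
          subst (λ q → Accepting (run q) _ _) (initial-state w)
            (run-accepting steps eq (initial-encodes w rep))

    simulated : QA.Accepts automaton w → TM.Accepts M w
    simulated t =
      let rep = read-⊢ (readFactor≢0 ⊢) start-represents
          _ , _ , rep′ , t′ = word-sound w (λ _ → refl) rep
            (read-sound ⊢ refl t (0<prob (readFactor ⊢ ⋆ readMatrix ⊢) (Q1AFA.start-ket automaton) 0F
              (Represents.nonzero rep)))
      in run-sound (initial w) (initial-state w) (initial-encodes w rep′) t′

theorem5 : ∀ {ℓ : Level} (k : ℕ) (L : Language k ℓ) → TuringRecognizable L → Q1AFARecognizable L
theorem5 k L (M , L⊆M , M⊆L) =
  automaton , (λ {w} w∈L → Run.simulates w (L⊆M w∈L)) , (λ {w} acc → M⊆L (Run.simulated w acc))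
  where open Simulation M
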